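{- Let $\Sigma$ be the first-order theory in the language $\{+,\cdot,0,1,<\}$ axiomatized by A1–A19 (described in the context). Then $\Sigma$ proves the following sentence $\mathbf{GS}^w$: for every prime $p$ there exists an element $n$ such that for every $m$ with $n\le m$ there exists $q$ with $1<q<m$, $q$ and $m$ relatively prime, $u$ and $q$ relatively prime for every prime $u\le p$, and $q$ not prime. (Equivalently: for every prime $p$ there is $n$ such that no $m\ge n$ is $p$-good.)
   Context: Language $\{+,\cdot,0,1,<\}$. Axioms A1–A15 (universal closures; together they form the theory $\mathrm{PA}^-$, whose models are the nonnegative parts of discretely ordered commutative rings): A1 $(x+y)+z=x+(y+z)$; A2 $x+y=y+x$; A3 $(xy)z=x(yz)$; A4 $xy=yx$; A5 $x(y+z)=xy+xz$; A6 $x+0=x\wedge x\cdot 0=0$; A7 $x\cdot1=x$; A8 $x<y\wedge y<z\to x<z$; A9 $\neg x<x$; A10 $x<y\vee x=y\vee y<x$; A11 $x<y\to x+z<y+z$; A12 $0<z\wedge x<y\to xz<yz$; A13 $x<y\to\exists z\,(x+z=y)$; A14 $0<1\wedge(x>0\to x\ge 1)$; A15 $x>0\vee x=0$. Notation: $\bar k$ denotes the numeral $1+1+\dots+1$ ($k$ ones), $\bar0=0$; $x\le y$ means $x<y\vee x=y$; $x\mid y$ means $\exists z\,(xz=y)$; $m,n$ are relatively prime if every common divisor $d$ of $m$ and $n$ equals $1$; $x$ is prime means $1<x$ and for all $a,b,c$, if $xc=ab$ then $x\mid a$ or $x\mid b$. Primes $a<b$ are consecutive if $b\le u$ for every prime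 $u>a$. A16: for every prime $p$ there is a prime $q>p$ with $q\le u$ for every prime $u>p$ (the successor prime $S(p)$). A17: for every prime $p>\bar2$ there is a prime $q<p$ with $u\le q$ for every prime $u<p$ (the predecessor prime $P(p)$). A18: for every $n>\bar4$ there is a prime $p$ with $p^2<n$ such that $n\le q^2$ for every prime $q>p$. A19: for all primes $r<p<q$ with $r,p$ consecutive, $p,q$ consecutive and $\overline{17}<q$, we have $q^2<\bar2pr$. For a prime $p$, an element $n$ is $p$-good if every $t$ with $1<t<n$, $t$ relatively prime to $n$, and $v$ relatively prime to $t$ for every prime $v\le p$, is prime. -}

module Defs where

open import Data.Nat using (ℕ; zero; suc)
open import Data.Product using (Σ; _×_; _,_)
open import Data.Sum using (_⊎_)
open import Relation.Nullary using (¬_)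
open import Relation.Binary.PropositionalEquality using (_≡_)

record Structure : Set₁ where
  field
    Carrier : Set
    _⊕_ : Carrier → Carrier → Carrier
    _⊗_ : Carrier → Carrier → Carrier
    𝟘 : Carrier
    𝟙 : Carrier
    _≺_ : Carrier → Carrier → Set

  infixl 6 _⊕_
  infixl 7 _⊗_
  infix 4 _≺_ _≼_ _∣_

  _≼_ : Carrier → Carrier → Set
  x ≼ y = x ≺ y ⊎ x ≡ y

  num : ℕ → Carrier
  num zero = 𝟘
  num (suc zero) = 𝟙
  num (suc (suc k)) = num (suc k) ⊕ 𝟙

  _∣_ : Carrier → Carrier → Set
  x ∣ y = Σ Carrier λ z → x ⊗ z ≡ y

  RelPrime : Carrier → Carrier → Set
  RelPrime m n = ∀ d → d ∣ m → d ∣ n → d ≡ 𝟙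

  IsPrime : Carrier → Set
  IsPrime x = (𝟙 ≺ x) × (∀ a b c → x ⊗ c ≡ a ⊗ b → (x ∣ a) ⊎ (x ∣ b))

  Consecutive : Carrier → Carrier → Set
  Consecutive a b = (a ≺ b) × (∀ u → IsPrime u → a ≺ u → b ≼ u)

  record Axioms : Set where
    field
      A1 : ∀ x y z → (x ⊕ y) ⊕ z ≡ x ⊕ (y ⊕ z)
      A2 : ∀ x y → x ⊕ y ≡ y ⊕ x
      A3 : ∀ x y z → (x ⊗ y) ⊗ z ≡ x ⊗ (y ⊗ z)
      A4 : ∀ x y → x ⊗ y ≡ y ⊗ x
      A5 : ∀ x y z → x ⊗ (y ⊕ z) ≡ x ⊗ y ⊕ x ⊗ z
      A6 : ∀ x → (x ⊕ 𝟘 ≡ x) × (x ⊗ 𝟘 ≡ 𝟘)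
      A7 : ∀ x → x ⊗ 𝟙 ≡ x
      A8 : ∀ x y z → x ≺ y → y ≺ z → x ≺ z
      A9 : ∀ x → ¬ (x ≺ x)
      A10 : ∀ x y → x ≺ y ⊎ x ≡ y ⊎ y ≺ x
      A11 : ∀ x y z → x ≺ y → x ⊕ z ≺ y ⊕ z
      A12 : ∀ x y z → 𝟘 ≺ z → x ≺ y → x ⊗ z ≺ y ⊗ z
      A13 : ∀ x y → x ≺ y → Σ Carrier λ z → x ⊕ z ≡ y
      A14 : (𝟘 ≺ 𝟙) × (∀ x → 𝟘 ≺ x → 𝟙 ≼ x)
      A15 : ∀ x → 𝟘 ≺ x ⊎ x ≡ 𝟘
      A16 : ∀ p → IsPrime p →
              Σ Carrier λ q → IsPrime q × p ≺ q × (∀ u → IsPrime u → p ≺ u → q ≼ u)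
      A17 : ∀ p → IsPrime p → num 2 ≺ p →
              Σ Carrier λ q → IsPrime q × q ≺ p × (∀ u → IsPrime u → u ≺ p → u ≼ q)
      A18 : ∀ n → num 4 ≺ n →
              Σ Carrier λ p → IsPrime p × p ⊗ p ≺ n × (∀ q → IsPrime q → p ≺ q → n ≼ q ⊗ q)
      A19 : ∀ r p q → IsPrime r → IsPrime p → IsPrime q → r ≺ p → p ≺ q →
              Consecutive r p → Consecutive p q → num 17 ≺ q →
              q ⊗ q ≺ (num 2 ⊗ p) ⊗ r

  GSw : Set
  GSw = ∀ p → IsPrime p →
          Σ Carrier λ n → ∀ m → n ≼ m →
            Σ Carrier λ q → (𝟙 ≺ q) × (q ≺ m) × RelPrime q m
              × (∀ u → IsPrime u → u ≼ p → RelPrime u q) × ¬ IsPrime q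

{-# OPTIONS --safe #-}
-- Let T be the fifteenth prime after p and m > T². By A18 there is a largest
-- prime r₀ with r₀² < m; it is at least T, so its two predecessor primes
-- r₂ < r₁ still lie above p, and the next prime s after r₀ satisfies
-- m ≤ s² by A18 and s² < 2r₀r₁ by A19. Hence r₀r₁r₂ (with r₂ ≥ 2) does not divide m, and for
-- an rᵢ with rᵢ ∤ m the composite rᵢ² < m is coprime to m and to every
-- prime u ≤ p.
module Submission where

open import Defs
open import Level using (0ℓ)
open import Axiom.ExcludedMiddle using (ExcludedMiddle)
open import Algebra.Bundles using (CommutativeSemigroup)
open import Data.Nat as ℕ using (ℕ; zero; suc; s≤s; z<s; s<s)
open import Data.Nat.Properties using (m≤n⇒m<n∨m≡n)
open import Data.Product using (Σ; _×_; _,_; proj₁; proj₂)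
open import Data.Sum using (_⊎_; inj₁; inj₂; [_,_])
open import Relation.Nullary using (¬_; Dec; yes; no; contradiction)
open import Relation.Binary.PropositionalEquality
  using (_≡_; _≢_; refl; sym; trans; cong; cong₂; subst; subst₂; isEquivalence;
         respˡ; respʳ; resp₂; module ≡-Reasoning)

module PAMinus (M : Structure) (ax : Structure.Axioms M) where
  open Structure M
  open Axioms ax
  open import Relation.Binary.Construct.StrictToNonStrict _≡_ _≺_ as NonStrict
    using ()
  open ≡-Reasoning

  <-trans : ∀ {x y z} → x ≺ y → y ≺ z → x ≺ z
  <-trans = A8 _ _ _

  <-≤-trans : ∀ {x y z} → x ≺ y → y ≼ z → x ≺ z
  <-≤-trans = NonStrict.<-≤-trans <-trans (respʳ _≺_)

  ≤-<-trans : ∀ {x y z} → x ≼ y → y ≺ z → x ≺ z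
  ≤-<-trans = NonStrict.≤-<-trans sym <-trans (respˡ _≺_)

  ≤-trans : ∀ {x y z} → x ≼ y → y ≼ z → x ≼ z
  ≤-trans = NonStrict.trans isEquivalence (resp₂ _≺_) <-trans

  <⇒≢ : ∀ {x y} → x ≺ y → x ≢ y
  <⇒≢ x<x refl = A9 _ x<x

  <⇒≱ : ∀ {x y} → x ≺ y → ¬ y ≼ x
  <⇒≱ x<y y≤x = A9 _ (<-≤-trans x<y y≤x)

  ≮⇒≥ : ∀ {x y} → ¬ x ≺ y → y ≼ x
  ≮⇒≥ {x} {y} x≮y with A10 x y
  ... | inj₁ x<y = contradiction x<y x≮y
  ... | inj₂ (inj₁ refl) = inj₂ refl
  ... | inj₂ (inj₂ y<x) = inj₁ y<x

  0<1 : 𝟘 ≺ 𝟙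
  0<1 = proj₁ A14

  0<⇒1≤ : ∀ {x} → 𝟘 ≺ x → 𝟙 ≼ x
  0<⇒1≤ = proj₂ A14 _

  1<⇒0< : ∀ {x} → 𝟙 ≺ x → 𝟘 ≺ x
  1<⇒0< = <-trans 0<1

  +-identityʳ : ∀ x → x ⊕ 𝟘 ≡ x
  +-identityʳ x = proj₁ (A6 x)

  +-monoʳ-< : ∀ x {y z} → y ≺ z → x ⊕ y ≺ x ⊕ z
  +-monoʳ-< x {y} {z} y<z = subst₂ _≺_ (A2 y x) (A2 z x) (A11 y z x y<z)

  +-monoʳ-≤ : ∀ x {y z} → y ≼ z → x ⊕ y ≼ x ⊕ z
  +-monoʳ-≤ x (inj₁ y<z) = inj₁ (+-monoʳ-< x y<z)
  +-monoʳ-≤ x (inj₂ refl) = inj₂ refl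

  x<x+1 : ∀ x → x ≺ x ⊕ 𝟙
  x<x+1 x = subst (_≺ x ⊕ 𝟙) (+-identityʳ x) (+-monoʳ-< x 0<1)

  <⇒+1≤ : ∀ {x y} → x ≺ y → x ⊕ 𝟙 ≼ y
  <⇒+1≤ {x} {y} x<y with A13 x y x<y
  ... | z , x+z≡y with A15 z
  ...   | inj₁ 0<z = subst (x ⊕ 𝟙 ≼_) x+z≡y (+-monoʳ-≤ x (0<⇒1≤ 0<z))
  ...   | inj₂ refl = contradiction (trans (sym (+-identityʳ x)) x+z≡y) (<⇒≢ x<y)

  *-commutativeSemigroup : CommutativeSemigroup 0ℓ 0ℓ
  *-commutativeSemigroup = record
    { Carrier = Carrier
    ; _≈_ = _≡_
    ; _∙_ = _⊗_
    ; isCommutativeSemigroup = record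
      { isSemigroup = record
        { isMagma = record { isEquivalence = isEquivalence ; ∙-cong = cong₂ _⊗_ }
        ; assoc = A3
        }
      ; comm = A4
      }
    }

  open import Algebra.Properties.CommutativeSemigroup *-commutativeSemigroup
    using (x∙yz≈y∙xz; xy∙z≈yz∙x)

  *-zeroˡ : ∀ x → 𝟘 ⊗ x ≡ 𝟘
  *-zeroˡ x = trans (A4 𝟘 x) (proj₂ (A6 x))

  *-zeroʳ : ∀ x → x ⊗ 𝟘 ≡ 𝟘
  *-zeroʳ x = proj₂ (A6 x)

  *-monoˡ-< : ∀ {x y z} → 𝟘 ≺ z → x ≺ y → x ⊗ z ≺ y ⊗ z
  *-monoˡ-< = A12 _ _ _

  *-monoʳ-< : ∀ {x y z} → 𝟘 ≺ z → x ≺ y → z ⊗ x ≺ z ⊗ y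
  *-monoʳ-< {x} {y} {z} 0<z x<y = subst₂ _≺_ (A4 x z) (A4 y z) (A12 x y z 0<z x<y)

  *-monoʳ-≤ : ∀ {x y z} → 𝟘 ≺ z → x ≼ y → z ⊗ x ≼ z ⊗ y
  *-monoʳ-≤ 0<z (inj₁ x<y) = inj₁ (*-monoʳ-< 0<z x<y)
  *-monoʳ-≤ 0<z (inj₂ refl) = inj₂ refl

  *-cancelˡ-≡ : ∀ {x y z} → 𝟘 ≺ x → x ⊗ y ≡ x ⊗ z → y ≡ z
  *-cancelˡ-≡ {x} {y} {z} 0<x xy≡xz with A10 y z
  ... | inj₁ y<z = contradiction xy≡xz (<⇒≢ (*-monoʳ-< 0<x y<z))
  ... | inj₂ (inj₁ y≡z) = y≡z
  ... | inj₂ (inj₂ z<y) = contradiction (sym xy≡xz) (<⇒≢ (*-monoʳ-< 0<x z<y))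

  *-positive : ∀ {x y} → 𝟘 ≺ x → 𝟘 ≺ y → 𝟘 ≺ x ⊗ y
  *-positive {x} 0<x 0<y = subst (_≺ x ⊗ _) (*-zeroʳ x) (*-monoʳ-< 0<x 0<y)

  x<x*x : ∀ {x} → 𝟙 ≺ x → x ≺ x ⊗ x
  x<x*x {x} 1<x = subst (_≺ x ⊗ x) (A7 x) (*-monoʳ-< (1<⇒0< 1<x) 1<x)

  x<y⇒x*x<y*y : ∀ {x y} → 𝟘 ≺ x → x ≺ y → x ⊗ x ≺ y ⊗ y
  x<y⇒x*x<y*y 0<x x<y = <-trans (*-monoʳ-< 0<x x<y) (*-monoˡ-< (<-trans 0<x x<y) x<y)

  ∣⇒≤ : ∀ {x y} → x ∣ y → 𝟘 ≺ y → x ≼ y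
  ∣⇒≤ {x} (k , xk≡y) 0<y with A15 x | A15 k
  ... | inj₂ refl | _ = inj₁ 0<y
  ... | inj₁ _ | inj₂ refl = contradiction (trans (sym (*-zeroʳ x)) xk≡y) (<⇒≢ 0<y)
  ... | inj₁ 0<x | inj₁ 0<k = subst₂ _≼_ (A7 x) xk≡y (*-monoʳ-≤ 0<x (0<⇒1≤ 0<k))

  m*n≡1⇒m≡1 : ∀ {x y} → x ⊗ y ≡ 𝟙 → x ≡ 𝟙
  m*n≡1⇒m≡1 {x} {y} xy≡1 with ∣⇒≤ (y , xy≡1) 0<1
  ... | inj₂ x≡1 = x≡1
  ... | inj₁ x<1 with A15 x
  ...   | inj₁ 0<x = contradiction (0<⇒1≤ 0<x) (<⇒≱ x<1)
  ...   | inj₂ refl = contradiction (trans (sym (*-zeroˡ y)) xy≡1) (<⇒≢ 0<1)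

  x*y≡x⇒y≡1 : ∀ {x y} → 𝟘 ≺ x → x ⊗ y ≡ x → y ≡ 𝟙
  x*y≡x⇒y≡1 {x} 0<x xy≡x = *-cancelˡ-≡ 0<x (trans xy≡x (sym (A7 x)))

  ∣-trans : ∀ {x y z} → x ∣ y → y ∣ z → x ∣ z
  ∣-trans {x} (a , xa≡y) (b , yb≡z) =
    a ⊗ b , trans (sym (A3 x a b)) (trans (cong (_⊗ b) xa≡y) yb≡z)

  prime⇒0< : ∀ {x} → IsPrime x → 𝟘 ≺ x
  prime⇒0< (1<x , _) = 1<⇒0< 1<x

  prime⇒2≤ : ∀ {x} → IsPrime x → num 2 ≼ x
  prime⇒2≤ (1<x , _) = <⇒+1≤ 1<x

  euclidsLemma : ∀ {u x y} → IsPrime u → u ∣ x ⊗ y → u ∣ x ⊎ u ∣ y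
  euclidsLemma (_ , euclid) (c , uc≡xy) = euclid _ _ c uc≡xy

  prime⇒irreducible : ∀ {u d} → IsPrime u → d ∣ u → d ≡ 𝟙 ⊎ d ≡ u
  prime⇒irreducible {u} {d} u-prime (e , de≡u)
    with euclidsLemma u-prime (𝟙 , trans (A7 u) (sym de≡u))
  ... | inj₁ (g , ug≡d) = inj₂ (begin
    d       ≡⟨ sym ug≡d ⟩
    u ⊗ g   ≡⟨ cong (u ⊗_) (m*n≡1⇒m≡1 (x*y≡x⇒y≡1 (prime⇒0< u-prime) ug*e≡u)) ⟩
    u ⊗ 𝟙   ≡⟨ A7 u ⟩
    u       ∎)
    where
    ug*e≡u : u ⊗ (g ⊗ e) ≡ u
    ug*e≡u = trans (sym (A3 u g e)) (trans (cong (_⊗ e) ug≡d) de≡u)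
  ... | inj₂ (f , uf≡e) = inj₁ (m*n≡1⇒m≡1 (x*y≡x⇒y≡1 (prime⇒0< u-prime) (begin
    u ⊗ (d ⊗ f)  ≡⟨ x∙yz≈y∙xz u d f ⟩
    d ⊗ (u ⊗ f)  ≡⟨ cong (d ⊗_) uf≡e ⟩
    d ⊗ e        ≡⟨ de≡u ⟩
    u            ∎)))

  prime-<⇒∤ : ∀ {a b} → IsPrime a → IsPrime b → a ≺ b → ¬ a ∣ b
  prime-<⇒∤ (1<a , _) b-prime a<b a∣b with prime⇒irreducible b-prime a∣b
  ... | inj₁ refl = A9 𝟙 1<a
  ... | inj₂ refl = A9 _ a<b

  prime∤⇒coprime : ∀ {a m} → IsPrime a → ¬ a ∣ m → RelPrime a m
  prime∤⇒coprime a-prime a∤m d d∣a d∣m with prime⇒irreducible a-prime d∣a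
  ... | inj₁ d≡1 = d≡1
  ... | inj₂ refl = contradiction d∣m a∤m

  prime∤* : ∀ {u x y} → IsPrime u → ¬ u ∣ x → ¬ u ∣ y → ¬ u ∣ x ⊗ y
  prime∤* u-prime u∤x u∤y u∣xy = [ u∤x , u∤y ] (euclidsLemma u-prime u∣xy)

  ∣m∧∣m⇒*∣m : ∀ {a b m} → IsPrime a → ¬ a ∣ b → a ∣ m → b ∣ m → b ⊗ a ∣ m
  ∣m∧∣m⇒*∣m {a} {b} {m} a-prime a∤b a∣m (y , by≡m)
    with euclidsLemma a-prime (subst (a ∣_) (sym by≡m) a∣m)
  ... | inj₁ a∣b = contradiction a∣b a∤b
  ... | inj₂ (z , az≡y) = z , (begin
    b ⊗ a ⊗ z    ≡⟨ A3 b a z ⟩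
    b ⊗ (a ⊗ z)  ≡⟨ cong (b ⊗_) az≡y ⟩
    b ⊗ y        ≡⟨ by≡m ⟩
    m            ∎)

  ∣-square-prime : ∀ {a d} → IsPrime a → d ∣ a ⊗ a → a ∣ d ⊎ d ∣ a
  ∣-square-prime {a} {d} a-prime (e , de≡aa) with euclidsLemma a-prime (a , sym de≡aa)
  ... | inj₁ a∣d = inj₁ a∣d
  ... | inj₂ (f , af≡e) = inj₂ (f , *-cancelˡ-≡ (prime⇒0< a-prime) (begin
    a ⊗ (d ⊗ f)  ≡⟨ x∙yz≈y∙xz a d f ⟩
    d ⊗ (a ⊗ f)  ≡⟨ cong (d ⊗_) af≡e ⟩
    d ⊗ e        ≡⟨ de≡aa ⟩
    a ⊗ a        ∎))

  square-coprime : ∀ {a m} → IsPrime a → ¬ a ∣ m → RelPrime (a ⊗ a) m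
  square-coprime a-prime a∤m d d∣aa d∣m with ∣-square-prime a-prime d∣aa
  ... | inj₁ a∣d = contradiction (∣-trans a∣d d∣m) a∤m
  ... | inj₂ d∣a = prime∤⇒coprime a-prime a∤m d d∣a d∣m

  coprime-square : ∀ {u a} → IsPrime u → IsPrime a → u ≺ a → RelPrime u (a ⊗ a)
  coprime-square {u} {a} u-prime a-prime u<a = prime∤⇒coprime u-prime (prime∤* u-prime u∤a u∤a)
    where
    u∤a : ¬ u ∣ a
    u∤a = prime-<⇒∤ u-prime a-prime u<a

  square-¬prime : ∀ {a} → 𝟙 ≺ a → ¬ IsPrime (a ⊗ a)
  square-¬prime {a} 1<a aa-prime = [ aa∤a , aa∤a ] (euclidsLemma aa-prime (𝟙 , A7 (a ⊗ a)))
    where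
    aa∤a : ¬ a ⊗ a ∣ a
    aa∤a aa∣a = <⇒≱ (x<x*x 1<a) (∣⇒≤ aa∣a (1<⇒0< 1<a))

  num-<-suc : ∀ k → num k ≺ num (suc k)
  num-<-suc zero = 0<1
  num-<-suc (suc k) = x<x+1 (num (suc k))

  num-mono-< : ∀ {j k} → j ℕ.< k → num j ≺ num k
  num-mono-< {j} {suc k} (s≤s j≤k) with m≤n⇒m<n∨m≡n j≤k
  ... | inj₁ j<k = <-trans (num-mono-< j<k) (num-<-suc k)
  ... | inj₂ refl = num-<-suc k

  maximal-below⇒consecutive : ∀ {q r} → q ≺ r →
    (∀ u → IsPrime u → u ≺ r → u ≼ q) → Consecutive q r
  maximal-below⇒consecutive q<r maximal =
    q<r , λ u u-prime q<u → ≮⇒≥ (λ u<r → <⇒≱ q<u (maximal u u-prime u<r))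

  ¬three-primes-∣ : ∀ {r₀ r₁ r₂ m} → IsPrime r₀ → IsPrime r₁ → IsPrime r₂ →
    r₂ ≺ r₁ → r₁ ≺ r₀ → 𝟘 ≺ m → m ≺ num 2 ⊗ r₀ ⊗ r₁ →
    r₀ ∣ m → r₁ ∣ m → ¬ r₂ ∣ m
  ¬three-primes-∣ {r₀} {r₁} {r₂} {m} r₀-prime r₁-prime r₂-prime r₂<r₁ r₁<r₀ 0<m m<2r₀r₁
    r₀∣m r₁∣m r₂∣m = <⇒≱ m<2r₀r₁ (≤-trans 2r₀r₁≤r₀r₁r₂ (∣⇒≤ r₀r₁r₂∣m 0<m))
    where
    r₀r₁∣m : r₀ ⊗ r₁ ∣ m
    r₀r₁∣m = ∣m∧∣m⇒*∣m r₁-prime (prime-<⇒∤ r₁-prime r₀-prime r₁<r₀) r₁∣m r₀∣m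
    r₂∤r₀r₁ : ¬ r₂ ∣ r₀ ⊗ r₁
    r₂∤r₀r₁ = prime∤* r₂-prime (prime-<⇒∤ r₂-prime r₀-prime (<-trans r₂<r₁ r₁<r₀))
                               (prime-<⇒∤ r₂-prime r₁-prime r₂<r₁)
    r₀r₁r₂∣m : r₀ ⊗ r₁ ⊗ r₂ ∣ m
    r₀r₁r₂∣m = ∣m∧∣m⇒*∣m r₂-prime r₂∤r₀r₁ r₂∣m r₀r₁∣m
    2r₀r₁≤r₀r₁r₂ : num 2 ⊗ r₀ ⊗ r₁ ≼ r₀ ⊗ r₁ ⊗ r₂
    2r₀r₁≤r₀r₁r₂ = subst (_≼ r₀ ⊗ r₁ ⊗ r₂) (sym (xy∙z≈yz∙x (num 2) r₀ r₁))
      (*-monoʳ-≤ (*-positive (prime⇒0< r₀-prime) (prime⇒0< r₁-prime)) (prime⇒2≤ r₂-prime))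

module NotGoodAbove (M : Structure) (ax : Structure.Axioms M) where
  open Structure M
  open Axioms ax
  open PAMinus M ax

  NotGood : Carrier → Carrier → Set
  NotGood p m = Σ Carrier λ q → (𝟙 ≺ q) × (q ≺ m) × RelPrime q m
                  × (∀ u → IsPrime u → u ≼ p → RelPrime u q) × ¬ IsPrime q

  square-witness : ∀ {p a m} → IsPrime a → p ≺ a → a ⊗ a ≺ m → ¬ a ∣ m → NotGood p m
  square-witness a-prime@(1<a , _) p<a aa<m a∤m =
      _ , <-trans 1<a (x<x*x 1<a) , aa<m , square-coprime a-prime a∤m
    , (λ u u-prime u≤p → coprime-square u-prime a-prime (≤-<-trans u≤p p<a))
    , square-¬prime 1<a

  witness-among-three : ExcludedMiddle 0ℓ → ∀ {p r₀ r₁ r₂ m} →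
    IsPrime r₀ → IsPrime r₁ → IsPrime r₂ → p ≺ r₂ → r₂ ≺ r₁ → r₁ ≺ r₀ →
    r₀ ⊗ r₀ ≺ m → m ≺ num 2 ⊗ r₀ ⊗ r₁ → NotGood p m
  witness-among-three em {p} {r₀} {r₁} {r₂} {m} r₀-prime r₁-prime r₂-prime
    p<r₂ r₂<r₁ r₁<r₀ r₀²<m m<2r₀r₁ = witness (em {r₀ ∣ m}) (em {r₁ ∣ m}) (em {r₂ ∣ m})
    where
    p<r₁ : p ≺ r₁
    p<r₁ = <-trans p<r₂ r₂<r₁
    p<r₀ : p ≺ r₀
    p<r₀ = <-trans p<r₁ r₁<r₀
    r₁²<m : r₁ ⊗ r₁ ≺ m
    r₁²<m = <-trans (x<y⇒x*x<y*y (prime⇒0< r₁-prime) r₁<r₀) r₀²<m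
    r₂²<m : r₂ ⊗ r₂ ≺ m
    r₂²<m = <-trans (x<y⇒x*x<y*y (prime⇒0< r₂-prime) r₂<r₁) r₁²<m
    0<m : 𝟘 ≺ m
    0<m = <-trans (*-positive (prime⇒0< r₀-prime) (prime⇒0< r₀-prime)) r₀²<m

    witness : Dec (r₀ ∣ m) → Dec (r₁ ∣ m) → Dec (r₂ ∣ m) → NotGood p m
    witness (no r₀∤m) _ _ = square-witness r₀-prime p<r₀ r₀²<m r₀∤m
    witness (yes _) (no r₁∤m) _ = square-witness r₁-prime p<r₁ r₁²<m r₁∤m
    witness (yes _) (yes _) (no r₂∤m) = square-witness r₂-prime p<r₂ r₂²<m r₂∤m
    witness (yes r₀∣m) (yes r₁∣m) (yes r₂∣m) = contradiction r₂∣m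
      (¬three-primes-∣ r₀-prime r₁-prime r₂-prime r₂<r₁ r₁<r₀ 0<m m<2r₀r₁ r₀∣m r₁∣m)

  module SuccessorPrimes {p : Carrier} (p-prime : IsPrime p) where
    S^ : ℕ → Carrier
    S^-prime : ∀ k → IsPrime (S^ k)

    S^ zero = p
    S^ (suc k) = proj₁ (A16 (S^ k) (S^-prime k))

    S^-prime zero = p-prime
    S^-prime (suc k) = proj₁ (proj₂ (A16 (S^ k) (S^-prime k)))

    S^-<-suc : ∀ k → S^ k ≺ S^ (suc k)
    S^-<-suc k = proj₁ (proj₂ (proj₂ (A16 (S^ k) (S^-prime k))))

    p<S^-suc : ∀ k → p ≺ S^ (suc k)
    p<S^-suc zero = S^-<-suc zero
    p<S^-suc (suc k) = <-trans (p<S^-suc k) (S^-<-suc (suc k))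

    num-≤-S^ : ∀ k → num (suc (suc k)) ≼ S^ k
    num-≤-S^ zero = prime⇒2≤ p-prime
    num-≤-S^ (suc k) = <⇒+1≤ (≤-<-trans (num-≤-S^ k) (S^-<-suc k))

    -- S^ 15 ≥ 17 makes A19 applicable above it, and two predecessor steps
    -- below a prime ≥ S^ 15 still stay above p.
    ¬good-above : ExcludedMiddle 0ℓ → ∀ {m} → S^ 15 ⊗ S^ 15 ≺ m → NotGood p m
    ¬good-above em {m} T²<m =
      let T<m : S^ 15 ≺ m
          T<m = <-trans (x<x*x (proj₁ (S^-prime 15))) T²<m
          4<m : num 4 ≺ m
          4<m = <-trans (<-≤-trans (num-mono-< {4} {17} (s<s (s<s (s<s (s<s z<s)))))
                                   (num-≤-S^ 15)) T<m
          (r₀ , r₀-prime , r₀²<m , m≤q²) = A18 m 4<m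
          T≤r₀ : S^ 15 ≼ r₀
          T≤r₀ = ≮⇒≥ λ r₀<T → <⇒≱ T²<m (m≤q² (S^ 15) (S^-prime 15) r₀<T)
          (r₁ , r₁-prime , r₁<r₀ , r₁-maximal) =
            A17 r₀ r₀-prime (≤-<-trans (prime⇒2≤ p-prime) (<-≤-trans (p<S^-suc 14) T≤r₀))
          S^14≤r₁ : S^ 14 ≼ r₁
          S^14≤r₁ = r₁-maximal (S^ 14) (S^-prime 14) (<-≤-trans (S^-<-suc 14) T≤r₀)
          (r₂ , r₂-prime , r₂<r₁ , r₂-maximal) =
            A17 r₁ r₁-prime (≤-<-trans (prime⇒2≤ p-prime) (<-≤-trans (p<S^-suc 13) S^14≤r₁))
          S^13≤r₂ : S^ 13 ≼ r₂
          S^13≤r₂ = r₂-maximal (S^ 13) (S^-prime 13) (<-≤-trans (S^-<-suc 13) S^14≤r₁)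
          (s , s-prime , r₀<s , s-minimal) = A16 r₀ r₀-prime
          17<s : num 17 ≺ s
          17<s = ≤-<-trans (≤-trans (num-≤-S^ 15) T≤r₀) r₀<s
          s²<2r₀r₁ : s ⊗ s ≺ num 2 ⊗ r₀ ⊗ r₁
          s²<2r₀r₁ = A19 r₁ r₀ s r₁-prime r₀-prime s-prime r₁<r₀ r₀<s
            (maximal-below⇒consecutive r₁<r₀ r₁-maximal) (r₀<s , s-minimal) 17<s
      in witness-among-three em r₀-prime r₁-prime r₂-prime
           (<-≤-trans (p<S^-suc 12) S^13≤r₂) r₂<r₁ r₁<r₀ r₀²<m
           (≤-<-trans (m≤q² s s-prime r₀<s) s²<2r₀r₁)

theorem4p1 : ExcludedMiddle 0ℓ →
    (M : Structure) → Structure.Axioms M → Structure.GSw M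
theorem4p1 em M ax p p-prime =
  T ⊗ T ⊕ 𝟙 , λ _ T²+1≤m → ¬good-above em (<-≤-trans (x<x+1 _) T²+1≤m)
  where
  open Structure M
  open PAMinus M ax
  open NotGoodAbove M ax
  open SuccessorPrimes p-prime
  T : Carrier
  T = S^ 15
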